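{- Let $m,n\ge1$, $A\in\mathbb{R}^{m\times n}$, $\mathbf{u},\mathbf{l}\in\mathbb{R}^n$, $C$ a finite set of ReLU constraints and $\mathcal{T}$ a proof tree. If $\mathrm{check\_tree}(A,\mathbf{u},\mathbf{l},C,\mathcal{T})$ returns true, then the DNN verification query $\langle A,\mathbf{u},\mathbf{l},C\rangle$ has no solution, i.e. there is no $\mathbf{s}\in\mathbb{R}^n$ with $A\mathbf{s}=\mathbf{0}$, $\mathbf{l}\le\mathbf{s}\le\mathbf{u}$ and $\mathbf{s}$ satisfying every constraint in $C$.
   Context: For vectors, $\mathbf{l}\le\mathbf{x}\le\mathbf{u}$ means $l_j\le x_j\le u_j$ for all $j=1,\dots,n$. A ReLU constraint is a triple $(b,f,a)$ of indices in $\{1,\dots,n\}$; $\mathbf{s}\in\mathbb{R}^n$ satisfies it if $s_f=\max(s_b,0)$ and $s_f-s_b-s_a=0$. A proof tree is either $\mathrm{Leaf}(w)$ with $w$ a finite list of reals, or $\mathrm{Node}(\sigma,\mathcal{T}^L,\mathcal{T}^R)$ with $\mathcal{T}^L,\mathcal{T}^R$ proof trees and $\sigma$ a split, which is either $\mathrm{SingleVar}(i,k)$ ($i$ an index, $k\in\mathbb{R}$) or $\mathrm{Relu}(b,f,a)$ ($b,f,a$ indices). A split is valid w.r.t. $C$ if it is $\mathrm{SingleVar}(i,k)$ with $1\le i\le n$, or $\mathrm{Relu}(b,f,a)$ with $(b,f,a)\in C$ and $b,f,a$ pairwise distinct. For $\mathbf{v}\in\mathbb{R}^n$, $\mathbf{v}[i\mapsto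 k]$ replaces the $i$-th entry by $k$. $\mathrm{update\_bounds}(\mathbf{l},\mathbf{u},\sigma)$ returns $((\mathbf{l}^L,\mathbf{u}^L),(\mathbf{l}^R,\mathbf{u}^R))$: for $\sigma=\mathrm{SingleVar}(i,k)$, $\mathbf{l}^L=\mathbf{l}$, $\mathbf{u}^L=\mathbf{u}[i\mapsto k]$, $\mathbf{l}^R=\mathbf{l}[i\mapsto k]$, $\mathbf{u}^R=\mathbf{u}$; for $\sigma=\mathrm{Relu}(b,f,a)$, $\mathbf{l}^L=\mathbf{l}[f\mapsto0]$, $\mathbf{u}^L=\mathbf{u}[b\mapsto0][f\mapsto0]$, $\mathbf{l}^R=\mathbf{l}[b\mapsto0][a\mapsto0]$, $\mathbf{u}^R=\mathbf{u}[a\mapsto0]$. The leaf check $\mathrm{leafcheck}(A,\mathbf{u},\mathbf{l},w)$ is true iff $w\in\mathbb{R}^m$ and, writing $\gamma=w^\intercal A\in\mathbb{R}^n$, $\sum_{j:\gamma_j>0}\gamma_ju_j+\sum_{j:\gamma_j<0}\gamma_jl_j<0$. Then $\mathrm{check\_tree}(A,\mathbf{u},\mathbf{l},C,\mathrm{Leaf}(w))=\mathrm{leafcheck}(A,\mathbf{u},\mathbf{l},w)$, and $\mathrm{check\_tree}(A,\mathbf{u},\mathbf{l},C,\mathrm{Node}(\sigma,\mathcal{T}^L,\mathcal{T}^R))$ is true iff $\sigma$ is valid w.r.t. $C$ and both $\mathrm{check\_tree}(A,\mathbf{u}^L,\mathbf{l}^L,C,\mathcal{T}^L)$ and $\mathrm{check\_tree}(A,\mathbf{u}^R,\mathbf{l}^R,C,\mathcal{T}^R)$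 are true, with $((\mathbf{l}^L,\mathbf{u}^L),(\mathbf{l}^R,\mathbf{u}^R))=\mathrm{update\_bounds}(\mathbf{l},\mathbf{u},\sigma)$. -}

module Defs where

open import Data.Nat.Base as ℕ using (ℕ; suc)
import Data.Nat.Properties as ℕₚ
open import Data.Fin.Base using (Fin; toℕ; cast)
open import Data.List.Base as List using (List; length; lookup)
open import Data.List.Membership.Propositional using (_∈_)
open import Data.Product.Base using (Σ; ∃; _×_; _,_; proj₁; proj₂)
open import Data.Rational.Base as ℚ using (ℚ; 0ℚ; 1ℚ; ½; ∣_∣)
import Data.Rational.Properties as ℚₚ
import Data.Rational.Solver as ℚSolver
open import Data.Sum.Base using (inj₁; inj₂)
open import Data.Vec.Functional using (Vector; foldr)
open import Relation.Binary.PropositionalEquality using (_≡_; _≢_; refl; sym; trans; cong; subst)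
open import Relation.Nullary.Decidable.Core using (yes; no)
open import Relation.Nullary.Negation.Core using (¬_)

------------------------------------------------------------------------
-- The reals as Cauchy sequences of rationals, up to null sequences.
-- Quotients being unavailable, ℝ is used as a setoid with equality _≃_.
-- Only the Cauchy proofs are abstract: the operations compute on seq.

Eventually : (ℕ → Set) → Set
Eventually P = ∃ λ N → ∀ n → N ℕ.≤ n → P n

Cauchy : (ℕ → ℚ) → Set
Cauchy x = ∀ ε → 0ℚ ℚ.< ε →
  ∃ λ N → ∀ m n → N ℕ.≤ m → N ℕ.≤ n → ∣ x m ℚ.- x n ∣ ℚ.< ε

record ℝ : Set where
  constructor mkℝ
  field
    seq    : ℕ → ℚ
    cauchy : Cauchy seq

open ℝ public

infix 4 _≃_ _≤_ _<_

_≃_ : ℝ → ℝ → Set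
x ≃ y = ∀ ε → 0ℚ ℚ.< ε → Eventually λ n → ∣ seq x n ℚ.- seq y n ∣ ℚ.< ε

_≤_ : ℝ → ℝ → Set
x ≤ y = ∀ ε → 0ℚ ℚ.< ε → Eventually λ n → seq x n ℚ.< seq y n ℚ.+ ε

_<_ : ℝ → ℝ → Set
x < y = ∃ λ ε → 0ℚ ℚ.< ε × Eventually λ n → seq x n ℚ.+ ε ℚ.< seq y n

private
  open ℚSolver.+-*-Solver using (solve; _:+_; _:*_; :-_; _:=_)

  half>0 : ∀ {ε} → 0ℚ ℚ.< ε → 0ℚ ℚ.< ½ ℚ.* ε
  half>0 {ε} ε>0 = subst (ℚ._< ½ ℚ.* ε) (ℚₚ.*-zeroʳ ½) (ℚₚ.*-monoʳ-<-pos ½ ε>0)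

  halves : ∀ ε → ½ ℚ.* ε ℚ.+ ½ ℚ.* ε ≡ ε
  halves ε = trans (sym (ℚₚ.*-distribʳ-+ ε ½ ½)) (ℚₚ.*-identityˡ ε)

  p≤∣p∣ : ∀ p → p ℚ.≤ ∣ p ∣
  p≤∣p∣ p with ℚₚ.≤-total 0ℚ p
  ... | inj₁ 0≤p = ℚₚ.≤-reflexive (sym (ℚₚ.0≤p⇒∣p∣≡p 0≤p))
  ... | inj₂ p≤0 = ℚₚ.≤-trans p≤0 (ℚₚ.0≤∣p∣ p)

  p≤q+∣p-q∣ : ∀ p q → p ℚ.≤ q ℚ.+ ∣ p ℚ.- q ∣
  p≤q+∣p-q∣ p q = subst (ℚ._≤ q ℚ.+ ∣ p ℚ.- q ∣)
    (solve 2 (λ p q → q :+ (p :+ :- q) := p) refl p q)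
    (ℚₚ.+-monoʳ-≤ q (p≤∣p∣ (p ℚ.- q)))

  p<q+ε⇒p-q<ε : ∀ {p q ε} → p ℚ.< q ℚ.+ ε → p ℚ.- q ℚ.< ε
  p<q+ε⇒p-q<ε {p} {q} {ε} h = subst (p ℚ.- q ℚ.<_)
    (solve 2 (λ q e → (q :+ e) :+ :- q := e) refl q ε)
    (ℚₚ.+-monoˡ-< (ℚ.- q) h)

  within : ∀ {p q ε} → p ℚ.< q ℚ.+ ε → q ℚ.< p ℚ.+ ε → ∣ p ℚ.- q ∣ ℚ.< ε
  within {p} {q} {ε} h k with ℚₚ.∣p∣≡p∨∣p∣≡-p (p ℚ.- q)
  ... | inj₁ e = subst (ℚ._< ε) (sym e) (p<q+ε⇒p-q<ε {p} {q} h)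
  ... | inj₂ e = subst (ℚ._< ε)
    (sym (trans e (solve 2 (λ p q → :- (p :+ :- q) := q :+ :- p) refl p q)))
    (p<q+ε⇒p-q<ε {q} {p} k)

  ⊔-< : ∀ {p q r} → p ℚ.< r → q ℚ.< r → p ℚ.⊔ q ℚ.< r
  ⊔-< {p} {q} {r} p<r q<r with ℚₚ.⊔-sel p q
  ... | inj₁ e = subst (ℚ._< r) (sym e) p<r
  ... | inj₂ e = subst (ℚ._< r) (sym e) q<r

  below : ∀ {p q ε} → ∣ p ℚ.- q ∣ ℚ.< ε → p ℚ.< q ℚ.+ ε
  below {p} {q} h = ℚₚ.≤-<-trans (p≤q+∣p-q∣ p q) (ℚₚ.+-monoʳ-< q h)

  ⊔-below : ∀ {p q r s ε} → ∣ p ℚ.- r ∣ ℚ.< ε → ∣ q ℚ.- s ∣ ℚ.< ε →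
            p ℚ.⊔ q ℚ.< (r ℚ.⊔ s) ℚ.+ ε
  ⊔-below {p} {q} {r} {s} {ε} h k = ⊔-<
    (ℚₚ.<-≤-trans (below {p} {r} h) (ℚₚ.+-monoˡ-≤ ε (ℚₚ.p≤p⊔q r s)))
    (ℚₚ.<-≤-trans (below {q} {s} k) (ℚₚ.+-monoˡ-≤ ε (ℚₚ.p≤q⊔p r s)))

  ∣p∣≤∣q∣+∣p-q∣ : ∀ p q → ∣ p ∣ ℚ.≤ ∣ q ∣ ℚ.+ ∣ p ℚ.- q ∣
  ∣p∣≤∣q∣+∣p-q∣ p q = subst (λ t → ∣ t ∣ ℚ.≤ ∣ q ∣ ℚ.+ ∣ p ℚ.- q ∣)
    (solve 2 (λ p q → q :+ (p :+ :- q) := p) refl p q)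
    (ℚₚ.∣p+q∣≤∣p∣+∣q∣ q (p ℚ.- q))

  0<1 : 0ℚ ℚ.< 1ℚ
  0<1 = ℚₚ.positive⁻¹ 1ℚ

  bounded : ∀ {x} → Cauchy x →
            ∃ λ B → 0ℚ ℚ.< B × Eventually λ n → ∣ x n ∣ ℚ.≤ B
  bounded {x} cx with cx 1ℚ 0<1
  ... | N , h = ∣ x N ∣ ℚ.+ 1ℚ
              , ℚₚ.+-mono-≤-< (ℚₚ.0≤∣p∣ (x N)) 0<1
              , N
              , λ n N≤n → ℚₚ.≤-trans (∣p∣≤∣q∣+∣p-q∣ (x n) (x N))
                  (ℚₚ.+-monoʳ-≤ ∣ x N ∣ (ℚₚ.<⇒≤ (h n N N≤n ℕₚ.≤-refl)))

  scaled : ∀ {B ε} → 0ℚ ℚ.< B → 0ℚ ℚ.< ε → ∃ λ δ → 0ℚ ℚ.< δ × B ℚ.* δ ≡ ε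
  scaled {B} {ε} B>0 ε>0 =
    1/B ℚ.* ε
    , ℚₚ.positive⁻¹ (1/B ℚ.* ε) {{ℚₚ.pos*pos⇒pos 1/B {{ℚₚ.1/pos⇒pos B}} ε}}
    , trans (sym (ℚₚ.*-assoc B 1/B ε))
        (trans (cong (ℚ._* ε) (ℚₚ.*-inverseʳ B)) (ℚₚ.*-identityˡ ε))
    where
    instance
      B-pos = ℚ.positive B>0
      ε-pos = ℚ.positive ε>0
      B-nz  = ℚₚ.pos⇒nonZero B
    1/B = ℚ.1/ B

  *-≤ : ∀ {p q B δ} → 0ℚ ℚ.< B → ∣ p ∣ ℚ.≤ B → ∣ q ∣ ℚ.< δ → ∣ p ℚ.* q ∣ ℚ.< B ℚ.* δ
  *-≤ {p} {q} {B} {δ} B>0 h k = subst (ℚ._< B ℚ.* δ) (sym (ℚₚ.∣p*q∣≡∣p∣*∣q∣ p q))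
    (ℚₚ.≤-<-trans (ℚₚ.*-monoʳ-≤-nonNeg ∣ q ∣ h) (ℚₚ.*-monoʳ-<-pos B k))
    where
    instance
      B-pos = ℚ.positive B>0
      q-nn  = ℚₚ.∣-∣-nonNeg q

  ∣+∣-< : ∀ {p q ε} → ∣ p ∣ ℚ.< ½ ℚ.* ε → ∣ q ∣ ℚ.< ½ ℚ.* ε → ∣ p ℚ.+ q ∣ ℚ.< ε
  ∣+∣-< {p} {q} {ε} h k = subst (∣ p ℚ.+ q ∣ ℚ.<_) (halves ε)
    (ℚₚ.≤-<-trans (ℚₚ.∣p+q∣≤∣p∣+∣q∣ p q) (ℚₚ.+-mono-< h k))

  abstract
    const-cauchy : ∀ q → Cauchy λ _ → q
    const-cauchy q ε ε>0 = 0 , λ _ _ _ _ →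
      subst (λ t → ∣ t ∣ ℚ.< ε) (sym (ℚₚ.+-inverseʳ q)) ε>0

  +-interchange : ∀ a b c d →
    (a ℚ.- b) ℚ.+ (c ℚ.- d) ≡ (a ℚ.+ c) ℚ.- (b ℚ.+ d)
  +-interchange = solve 4
    (λ a b c d → (a :+ :- b) :+ (c :+ :- d) := (a :+ c) :+ :- (b :+ d)) refl

  abstract
    +-cauchy : ∀ {x y} → Cauchy x → Cauchy y → Cauchy λ n → x n ℚ.+ y n
    +-cauchy {x} {y} cx cy ε ε>0 with cx _ (half>0 ε>0) | cy _ (half>0 ε>0)
    ... | M , h | N , k = M ℕ.⊔ N , λ m n m≥ n≥ →
      subst (λ t → ∣ t ∣ ℚ.< ε)
        (+-interchange (x m) (x n) (y m) (y n))
        (∣+∣-< {x m ℚ.- x n} {y m ℚ.- y n} {ε}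
               (h m n (ℕₚ.m⊔n≤o⇒m≤o M N m≥) (ℕₚ.m⊔n≤o⇒m≤o M N n≥))
               (k m n (ℕₚ.m⊔n≤o⇒n≤o M N m≥) (ℕₚ.m⊔n≤o⇒n≤o M N n≥)))

  abstract
    neg-cauchy : ∀ {x} → Cauchy x → Cauchy λ n → ℚ.- x n
    neg-cauchy {x} cx ε ε>0 with cx ε ε>0
    ... | N , h = N , λ m n m≥ n≥ →
      subst (λ t → ∣ t ∣ ℚ.< ε)
        (solve 2 (λ a b → b :+ :- a := :- a :+ :- (:- b)) refl (x m) (x n))
        (h n m n≥ m≥)

  *-telescope : ∀ a b c d →
    a ℚ.* (c ℚ.- d) ℚ.+ d ℚ.* (a ℚ.- b) ≡ a ℚ.* c ℚ.- b ℚ.* d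
  *-telescope = solve 4
    (λ a b c d → a :* (c :+ :- d) :+ d :* (a :+ :- b) := a :* c :+ :- (b :* d)) refl

  *-within : ∀ {a b c d B D β δ ε} → 0ℚ ℚ.< B → 0ℚ ℚ.< D →
    B ℚ.* β ≡ ½ ℚ.* ε → D ℚ.* δ ≡ ½ ℚ.* ε → ∣ a ∣ ℚ.≤ B → ∣ d ∣ ℚ.≤ D →
    ∣ c ℚ.- d ∣ ℚ.< β → ∣ a ℚ.- b ∣ ℚ.< δ → ∣ a ℚ.* c ℚ.- b ℚ.* d ∣ ℚ.< ε
  *-within {a} {b} {c} {d} {B} {D} {β} {δ} {ε} B>0 D>0 eβ eδ a≤B d≤D cd ab =
    subst (λ t → ∣ t ∣ ℚ.< ε) (*-telescope a b c d)
      (∣+∣-< {a ℚ.* (c ℚ.- d)} {d ℚ.* (a ℚ.- b)} {ε}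
        (subst (∣ a ℚ.* (c ℚ.- d) ∣ ℚ.<_) eβ (*-≤ {a} {c ℚ.- d} {B} {β} B>0 a≤B cd))
        (subst (∣ d ℚ.* (a ℚ.- b) ∣ ℚ.<_) eδ (*-≤ {d} {a ℚ.- b} {D} {δ} D>0 d≤D ab)))

  abstract
    *-cauchy : ∀ {x y} → Cauchy x → Cauchy y → Cauchy λ n → x n ℚ.* y n
    *-cauchy {x} {y} cx cy ε ε>0 =
      let B , B>0 , M , hB = bounded {x} cx
          D , D>0 , N , hD = bounded {y} cy
          β , β>0 , eβ     = scaled {B} {½ ℚ.* ε} B>0 (half>0 {ε} ε>0)
          δ , δ>0 , eδ     = scaled {D} {½ ℚ.* ε} D>0 (half>0 {ε} ε>0)
          P , k            = cy β β>0
          Q , h            = cx δ δ>0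
      in (M ℕ.⊔ N) ℕ.⊔ (P ℕ.⊔ Q) , λ m n m≥ n≥ →
        let MN≤m = ℕₚ.m⊔n≤o⇒m≤o (M ℕ.⊔ N) (P ℕ.⊔ Q) m≥
            MN≤n = ℕₚ.m⊔n≤o⇒m≤o (M ℕ.⊔ N) (P ℕ.⊔ Q) n≥
            PQ≤m = ℕₚ.m⊔n≤o⇒n≤o (M ℕ.⊔ N) (P ℕ.⊔ Q) m≥
            PQ≤n = ℕₚ.m⊔n≤o⇒n≤o (M ℕ.⊔ N) (P ℕ.⊔ Q) n≥
        in *-within {x m} {x n} {y m} {y n} {B} {D} {β} {δ} {ε} B>0 D>0 eβ eδ
             (hB m (ℕₚ.m⊔n≤o⇒m≤o M N MN≤m)) (hD n (ℕₚ.m⊔n≤o⇒n≤o M N MN≤n))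
             (k m n (ℕₚ.m⊔n≤o⇒m≤o P Q PQ≤m) (ℕₚ.m⊔n≤o⇒m≤o P Q PQ≤n))
             (h m n (ℕₚ.m⊔n≤o⇒n≤o P Q PQ≤m) (ℕₚ.m⊔n≤o⇒n≤o P Q PQ≤n))

  abstract
    ⊔-cauchy : ∀ {x y} → Cauchy x → Cauchy y → Cauchy λ n → x n ℚ.⊔ y n
    ⊔-cauchy {x} {y} cx cy ε ε>0 with cx ε ε>0 | cy ε ε>0
    ... | M , h | N , k = M ℕ.⊔ N , λ m n m≥ n≥ →
      let M≤m = ℕₚ.m⊔n≤o⇒m≤o M N m≥ ; M≤n = ℕₚ.m⊔n≤o⇒m≤o M N n≥
          N≤m = ℕₚ.m⊔n≤o⇒n≤o M N m≥ ; N≤n = ℕₚ.m⊔n≤o⇒n≤o M N n≥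
      in within {x m ℚ.⊔ y m} {x n ℚ.⊔ y n}
           (⊔-below {x m} {y m} {x n} {y n} (h m n M≤m M≤n) (k m n N≤m N≤n))
           (⊔-below {x n} {y n} {x m} {y m} (h n m M≤n M≤m) (k n m N≤n N≤m))

0ℝ : ℝ
0ℝ = mkℝ (λ _ → 0ℚ) (const-cauchy 0ℚ)

infixl 6 _+_ _-_
infixl 7 _*_

_+_ : ℝ → ℝ → ℝ
x + y = mkℝ (λ n → seq x n ℚ.+ seq y n) (+-cauchy {seq x} {seq y} (cauchy x) (cauchy y))

-_ : ℝ → ℝ
- x = mkℝ (λ n → ℚ.- seq x n) (neg-cauchy {seq x} (cauchy x))

_-_ : ℝ → ℝ → ℝ
x - y = x + (- y)

_*_ : ℝ → ℝ → ℝ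
x * y = mkℝ (λ n → seq x n ℚ.* seq y n) (*-cauchy {seq x} {seq y} (cauchy x) (cauchy y))

max : ℝ → ℝ → ℝ
max x y = mkℝ (λ n → seq x n ℚ.⊔ seq y n) (⊔-cauchy {seq x} {seq y} (cauchy x) (cauchy y))

------------------------------------------------------------------------
-- Vectors and matrices

Matrix : ℕ → ℕ → Set
Matrix m n = Fin m → Fin n → ℝ

sum : ∀ {n} → Vector ℝ n → ℝ
sum = foldr _+_ 0ℝ

infixl 7 _*ᵛ_ _ᵛ*_

_*ᵛ_ : ∀ {m n} → Matrix m n → Vector ℝ n → Vector ℝ m
(A *ᵛ x) i = sum λ j → A i j * x j

_ᵛ*_ : ∀ {m n} → Vector ℝ m → Matrix m n → Vector ℝ n
(w ᵛ* A) j = sum λ i → w i * A i j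

infix 4 _≤ᵛ_

_≤ᵛ_ : ∀ {n} → Vector ℝ n → Vector ℝ n → Set
x ≤ᵛ y = ∀ j → x j ≤ y j

-- Indices in proof trees are natural numbers counted from 1, independent of
-- the dimension; position j is the index of the coordinate j.
position : ∀ {n} → Fin n → ℕ
position j = suc (toℕ j)

infixl 8 _[_↦_]

_[_↦_] : ∀ {n} → Vector ℝ n → ℕ → ℝ → Vector ℝ n
(v [ i ↦ k ]) j with position j ℕₚ.≟ i
... | yes _ = k
... | no  _ = v j

------------------------------------------------------------------------
-- Queries

ReluConstraint : ℕ → Set
ReluConstraint n = Fin n × Fin n × Fin n

Satisfies : ∀ {n} → Vector ℝ n → ReluConstraint n → Set
Satisfies s (b , f , a) = s f ≃ max (s b) 0ℝ × s f - s b - s a ≃ 0ℝ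

-- A finite set of constraints is given by a list enumerating it; only
-- membership in the list is ever used.
record IsSolution {m n} (A : Matrix m n) (u l : Vector ℝ n)
                  (C : List (ReluConstraint n)) (s : Vector ℝ n) : Set where
  field
    kernel      : ∀ i → (A *ᵛ s) i ≃ 0ℝ
    lower       : l ≤ᵛ s
    upper       : s ≤ᵛ u
    constraints : ∀ c → c ∈ C → Satisfies s c

------------------------------------------------------------------------
-- Proof trees

data Split : Set where
  SingleVar : (i : ℕ) (k : ℝ) → Split
  Relu      : (b f a : ℕ) → Split

data ProofTree : Set where
  Leaf : List ℝ → ProofTree
  Node : Split → ProofTree → ProofTree → ProofTree

positions : ∀ {n} → ReluConstraint n → ℕ × ℕ × ℕ
positions (b , f , a) = position b , position f , position a

ValidSplit : ∀ {n} → List (ReluConstraint n) → Split → Set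
ValidSplit {n} C (SingleVar i k) = 1 ℕ.≤ i × i ℕ.≤ n
ValidSplit     C (Relu b f a)    =
  (b , f , a) ∈ List.map positions C × b ≢ f × f ≢ a × b ≢ a

Bounds : ℕ → Set
Bounds n = Vector ℝ n × Vector ℝ n

updateBounds : ∀ {n} → Vector ℝ n → Vector ℝ n → Split → Bounds n × Bounds n
updateBounds l u (SingleVar i k) =
  (l , u [ i ↦ k ]) , (l [ i ↦ k ] , u)
updateBounds l u (Relu b f a) =
  (l [ f ↦ 0ℝ ] , u [ b ↦ 0ℝ ] [ f ↦ 0ℝ ]) ,
  (l [ b ↦ 0ℝ ] [ a ↦ 0ℝ ] , u [ a ↦ 0ℝ ])

-- SumOver P f σ: σ is the sum of f j over those j with P j. It is a relation
-- because the sign of a real is not decidable, so that the summand extended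
-- by 0 cannot be defined by cases. For P j = (0 < γ j) and f j = γ j * u j such
-- a σ exists (take t j = max (γ j) 0 * u j) and is unique up to _≃_, as _≃_ is
-- stable under double negation; similarly for P j = (γ j < 0).
SumOver : ∀ {n} → (Fin n → Set) → Vector ℝ n → ℝ → Set
SumOver {n} P f σ = Σ (Vector ℝ n) λ t →
  (∀ j → P j → t j ≃ f j) × (∀ j → ¬ P j → t j ≃ 0ℝ) × σ ≃ sum t

-- The checks are decisions over ℝ, hence propositions "the check returns
-- true" rather than Boolean functions.
LeafCheck : ∀ {m n} → Matrix m n → Vector ℝ n → Vector ℝ n → List ℝ → Set
LeafCheck {m} A u l w = Σ (length w ≡ m) λ len →
  let γ = (λ i → lookup w (cast (sym len) i)) ᵛ* A in
  Σ ℝ λ σ⁺ → Σ ℝ λ σ⁻ →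
    SumOver (λ j → 0ℝ < γ j) (λ j → γ j * u j) σ⁺ ×
    SumOver (λ j → γ j < 0ℝ) (λ j → γ j * l j) σ⁻ ×
    σ⁺ + σ⁻ < 0ℝ

CheckTree : ∀ {m n} → Matrix m n → Vector ℝ n → Vector ℝ n →
            List (ReluConstraint n) → ProofTree → Set
CheckTree A u l C (Leaf w)       = LeafCheck A u l w
CheckTree A u l C (Node σ Tᴸ Tᴿ) =
  let ((lᴸ , uᴸ) , (lᴿ , uᴿ)) = updateBounds l u σ in
  ValidSplit C σ × CheckTree A uᴸ lᴸ C Tᴸ × CheckTree A uᴿ lᴿ C Tᴿ

{-# OPTIONS --safe #-}
-- The conclusion is negative, so comparisons of reals may be decided under
-- double negation. At a split, s lies in at least one of the two halves: for
-- SingleVar i k since s i ≤ k or k ≤ s i, for a ReLU since the active and the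
-- inactive phase pin down the same coordinates as the updated bounds. At a leaf
-- the check is a Farkas certificate: with γ = wᵀA,
--   0 = wᵀ(A s) = Σ γ j s j ≤ Σ_{γ j > 0} γ j u j + Σ_{γ j < 0} γ j l j < 0.
module Submission where

open import Defs
open import Algebra.Bundles using (CommutativeRing)
import Algebra.Properties.Semiring.Sum as SemiringSum
open import Data.Empty using (⊥)
open import Data.Fin.Base using (Fin; zero; suc; cast; fromℕ<)
open import Data.Fin.Properties using (toℕ-fromℕ<; toℕ-injective)
open import Data.Integer.Base using (+_)
open import Data.List.Base using (List; lookup)
open import Data.List.Membership.Propositional using (_∈_)
open import Data.List.Membership.Propositional.Properties using (∈-map⁻)
open import Data.Nat.Base as ℕ using (ℕ; _≥_)
import Data.Nat.Properties as ℕₚ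
open import Data.Product.Base using (∃; _×_; _,_; proj₁; proj₂)
open import Data.Rational.Base as ℚ using (ℚ; 0ℚ; 1ℚ; ½; ∣_∣)
import Data.Rational.Properties as ℚₚ
import Data.Rational.Solver as ℚSolver
open import Data.Sum.Base using (_⊎_; inj₁; inj₂; [_,_]′)
open import Data.Vec.Functional using (Vector)
open import Level using (0ℓ)
open import Relation.Binary.PropositionalEquality using (_≡_; refl; sym; trans; cong; subst)
import Relation.Binary.Reasoning.Setoid as SetoidReasoning
open import Relation.Nullary.Decidable.Core using (yes; no)
open import Relation.Nullary.Negation.Core using (¬_; contradiction)

open ℚSolver.+-*-Solver using (solve; con; _:+_; _:*_; :-_; _:=_)

-- Rational estimates

½-pos : ∀ {ε} → 0ℚ ℚ.< ε → 0ℚ ℚ.< ½ ℚ.* ε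
½-pos = ℚₚ.*-monoʳ-<-pos ½

½+½ : ∀ ε → ½ ℚ.* ε ℚ.+ ½ ℚ.* ε ≡ ε
½+½ = solve 1 (λ ε → con ½ :* ε :+ con ½ :* ε := ε) refl

p≤∣p∣ : ∀ p → p ℚ.≤ ∣ p ∣
p≤∣p∣ p with ℚₚ.≤-total 0ℚ p
... | inj₁ 0≤p = ℚₚ.≤-reflexive (sym (ℚₚ.0≤p⇒∣p∣≡p 0≤p))
... | inj₂ p≤0 = ℚₚ.≤-trans p≤0 (ℚₚ.0≤∣p∣ p)

∣p-q∣<ε⇒p<q+ε : ∀ p q {ε} → ∣ p ℚ.- q ∣ ℚ.< ε → p ℚ.< q ℚ.+ ε
∣p-q∣<ε⇒p<q+ε p q {ε} h = begin-strict
  p                     ≡⟨ solve 2 (λ p q → p := q :+ (p :+ :- q)) refl p q ⟩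
  q ℚ.+ (p ℚ.- q)       ≤⟨ ℚₚ.+-monoʳ-≤ q (p≤∣p∣ (p ℚ.- q)) ⟩
  q ℚ.+ ∣ p ℚ.- q ∣     <⟨ ℚₚ.+-monoʳ-< q h ⟩
  q ℚ.+ ε               ∎
  where open ℚₚ.≤-Reasoning

p<q+ε⇒p-q<ε : ∀ p q {ε} → p ℚ.< q ℚ.+ ε → p ℚ.- q ℚ.< ε
p<q+ε⇒p-q<ε p q {ε} h = begin-strict
  p ℚ.- q           <⟨ ℚₚ.+-monoˡ-< (ℚ.- q) h ⟩
  (q ℚ.+ ε) ℚ.- q   ≡⟨ solve 2 (λ q e → (q :+ e) :+ :- q := e) refl q ε ⟩
  ε                 ∎
  where open ℚₚ.≤-Reasoning

p<q+ε∧q<p+ε⇒∣p-q∣<ε : ∀ p q {ε} → p ℚ.< q ℚ.+ ε → q ℚ.< p ℚ.+ ε → ∣ p ℚ.- q ∣ ℚ.< ε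
p<q+ε∧q<p+ε⇒∣p-q∣<ε p q {ε} h k with ℚₚ.∣p∣≡p∨∣p∣≡-p (p ℚ.- q)
... | inj₁ e = subst (ℚ._< ε) (sym e) (p<q+ε⇒p-q<ε p q h)
... | inj₂ e = subst (ℚ._< ε)
  (sym (trans e (solve 2 (λ p q → :- (p :+ :- q) := q :+ :- p) refl p q)))
  (p<q+ε⇒p-q<ε q p k)

p<p+ε : ∀ p {ε} → 0ℚ ℚ.< ε → p ℚ.< p ℚ.+ ε
p<p+ε p {ε} ε>0 = subst (ℚ._< p ℚ.+ ε) (ℚₚ.+-identityʳ p) (ℚₚ.+-monoʳ-< p ε>0)

-- Supplies the tolerance for one factor of a product when the other factor is bounded by `B`; the
-- witness is `ε / B`.
rescale : ∀ {B ε} → 0ℚ ℚ.< B → 0ℚ ℚ.< ε → ∃ λ δ → 0ℚ ℚ.< δ × B ℚ.* δ ≡ ε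
rescale {B} {ε} B>0 ε>0 =
  ℚ.1/ B ℚ.* ε
  , ℚₚ.positive⁻¹ (ℚ.1/ B ℚ.* ε) {{ℚₚ.pos*pos⇒pos (ℚ.1/ B) {{ℚₚ.1/pos⇒pos B}} ε}}
  , trans (sym (ℚₚ.*-assoc B (ℚ.1/ B) ε))
      (trans (cong (ℚ._* ε) (ℚₚ.*-inverseʳ B)) (ℚₚ.*-identityˡ ε))
  where
  instance
    _ = ℚ.positive B>0
    _ = ℚ.positive ε>0
    _ = ℚₚ.pos⇒nonZero B

-- Eventual properties

always : ∀ {P : ℕ → Set} → (∀ n → P n) → Eventually P
always p = 0 , λ n _ → p n

eventually-map : ∀ {P Q : ℕ → Set} → (∀ n → P n → Q n) → Eventually P → Eventually Q
eventually-map f (N , p) = N , λ n N≤n → f n (p n N≤n)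

eventually-map₂ : ∀ {P Q R : ℕ → Set} → (∀ n → P n → Q n → R n) →
                  Eventually P → Eventually Q → Eventually R
eventually-map₂ f (M , p) (N , q) = M ℕ.⊔ N , λ n M⊔N≤n →
  f n (p n (ℕₚ.m⊔n≤o⇒m≤o M N M⊔N≤n)) (q n (ℕₚ.m⊔n≤o⇒n≤o M N M⊔N≤n))

eventually-absurd : Eventually (λ _ → ⊥) → ⊥
eventually-absurd (N , absurd) = absurd N ℕₚ.≤-refl

-- Past the Cauchy index for tolerance 1, all terms stay within 1 of the single term `seq x N`.
bounded : ∀ x → ∃ λ B → 0ℚ ℚ.< B × Eventually λ n → ∣ seq x n ∣ ℚ.< B
bounded x = let N , h = cauchy x 1ℚ 0<1 in
  ∣ seq x N ∣ ℚ.+ 1ℚ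
  , ℚₚ.+-mono-≤-< (ℚₚ.0≤∣p∣ (seq x N)) 0<1
  , N
  , λ n N≤n → begin-strict
      ∣ seq x n ∣
        ≡⟨ cong ∣_∣ (solve 2 (λ p q → p := q :+ (p :+ :- q)) refl (seq x n) (seq x N)) ⟩
      ∣ seq x N ℚ.+ (seq x n ℚ.- seq x N) ∣
        ≤⟨ ℚₚ.∣p+q∣≤∣p∣+∣q∣ (seq x N) (seq x n ℚ.- seq x N) ⟩
      ∣ seq x N ∣ ℚ.+ ∣ seq x n ℚ.- seq x N ∣
        <⟨ ℚₚ.+-monoʳ-< ∣ seq x N ∣ (h n N N≤n ℕₚ.≤-refl) ⟩
      ∣ seq x N ∣ ℚ.+ 1ℚ ∎
  where
  open ℚₚ.≤-Reasoning
  0<1 : 0ℚ ℚ.< 1ℚ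
  0<1 = ℚₚ.positive⁻¹ 1ℚ

-- Order and equality of reals

pointwise⇒≤ : ∀ x y → (∀ n → seq x n ℚ.≤ seq y n) → x ≤ y
pointwise⇒≤ x y h ε ε>0 = always λ n → ℚₚ.≤-<-trans (h n) (p<p+ε (seq y n) ε>0)

≤-trans : ∀ x y z → x ≤ y → y ≤ z → x ≤ z
≤-trans x y z x≤y y≤z ε ε>0 =
  eventually-map₂ step (x≤y _ (½-pos ε>0)) (y≤z _ (½-pos ε>0))
  where
  step : ∀ n → seq x n ℚ.< seq y n ℚ.+ ½ ℚ.* ε → seq y n ℚ.< seq z n ℚ.+ ½ ℚ.* ε →
         seq x n ℚ.< seq z n ℚ.+ ε
  step n h k = begin-strict
    seq x n                               <⟨ h ⟩
    seq y n ℚ.+ ½ ℚ.* ε                   <⟨ ℚₚ.+-monoˡ-< (½ ℚ.* ε) k ⟩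
    seq z n ℚ.+ ½ ℚ.* ε ℚ.+ ½ ℚ.* ε       ≡⟨ ℚₚ.+-assoc (seq z n) _ _ ⟩
    seq z n ℚ.+ (½ ℚ.* ε ℚ.+ ½ ℚ.* ε)     ≡⟨ cong (seq z n ℚ.+_) (½+½ ε) ⟩
    seq z n ℚ.+ ε                         ∎
    where open ℚₚ.≤-Reasoning

≃⇒≤ : ∀ x y → x ≃ y → x ≤ y
≃⇒≤ x y x≃y ε ε>0 =
  eventually-map (λ n → ∣p-q∣<ε⇒p<q+ε (seq x n) (seq y n)) (x≃y ε ε>0)

≤-antisym : ∀ x y → x ≤ y → y ≤ x → x ≃ y
≤-antisym x y x≤y y≤x ε ε>0 =
  eventually-map₂ (λ n → p<q+ε∧q<p+ε⇒∣p-q∣<ε (seq x n) (seq y n)) (x≤y ε ε>0) (y≤x ε ε>0)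

-- The operations on reals compute term by term, so identities of rationals pass to the reals
-- through this lemma; the ring laws below are obtained in this way.
pointwise⇒≃ : ∀ x y → (∀ n → seq x n ≡ seq y n) → x ≃ y
pointwise⇒≃ x y h = ≤-antisym x y
  (pointwise⇒≤ x y λ n → ℚₚ.≤-reflexive (h n))
  (pointwise⇒≤ y x λ n → ℚₚ.≤-reflexive (sym (h n)))

≃-refl : ∀ x → x ≃ x
≃-refl x = pointwise⇒≃ x x λ _ → refl

≃-sym : ∀ x y → x ≃ y → y ≃ x
≃-sym x y x≃y ε ε>0 = eventually-map
  (λ n → subst (ℚ._< ε) (trans
    (sym (ℚₚ.∣-p∣≡∣p∣ (seq x n ℚ.- seq y n)))
    (cong ∣_∣ (solve 2 (λ p q → :- (p :+ :- q) := q :+ :- p) refl (seq x n) (seq y n)))))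
  (x≃y ε ε>0)

≃-trans : ∀ x y z → x ≃ y → y ≃ z → x ≃ z
≃-trans x y z x≃y y≃z = ≤-antisym x z
  (≤-trans x y z (≃⇒≤ x y x≃y) (≃⇒≤ y z y≃z))
  (≤-trans z y x (≃⇒≤ z y (≃-sym y z y≃z)) (≃⇒≤ y x (≃-sym x y x≃y)))

<⇒≤ : ∀ x y → x < y → x ≤ y
<⇒≤ x y (δ , δ>0 , x+δ<y) ε ε>0 = eventually-map
  (λ n h → ℚₚ.<-trans (p<p+ε (seq x n) δ>0) (ℚₚ.<-trans h (p<p+ε (seq y n) ε>0)))
  x+δ<y

-- The gap `ε` witnessing `y < x` is taken as the tolerance in `x ≤ y`; at a late index the two
-- rational inequalities contradict each other.
≤⇒≯ : ∀ x y → x ≤ y → ¬ (y < x)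
≤⇒≯ x y x≤y (ε , ε>0 , y+ε<x) =
  eventually-absurd (eventually-map₂ (λ _ → ℚₚ.<-asym) (x≤y ε ε>0) y+ε<x)

⅕ : ℚ
⅕ = + 1 ℚ./ 5

-- Comparing single terms x N and y N + 3e of sequences that are within
-- e = ε / 5 of their limits either bounds x by y + ε or separates y from x.
≯⇒≤ : ∀ x y → ¬ (y < x) → x ≤ y
≯⇒≤ x y y≮x ε ε>0 = helper (cauchy x e e>0) (cauchy y e e>0)
  where
  open ℚₚ.≤-Reasoning
  e = ⅕ ℚ.* ε
  e>0 : 0ℚ ℚ.< e
  e>0 = ℚₚ.*-monoʳ-<-pos ⅕ ε>0
  3e = e ℚ.+ e ℚ.+ e

  helper : (∃ λ N → ∀ m n → N ℕ.≤ m → N ℕ.≤ n → ∣ seq x m ℚ.- seq x n ∣ ℚ.< e) →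
           (∃ λ N → ∀ m n → N ℕ.≤ m → N ℕ.≤ n → ∣ seq y m ℚ.- seq y n ∣ ℚ.< e) →
           Eventually λ n → seq x n ℚ.< seq y n ℚ.+ ε
  helper (M , h) (M′ , k) with seq x (M ℕ.⊔ M′) ℚₚ.<? seq y (M ℕ.⊔ M′) ℚ.+ 3e
  ... | yes close = N , λ n N≤n → begin-strict
    seq x n
      <⟨ ∣p-q∣<ε⇒p<q+ε (seq x n) (seq x N) (h n N (ℕₚ.m⊔n≤o⇒m≤o M M′ N≤n) (ℕₚ.m≤m⊔n M M′)) ⟩
    seq x N ℚ.+ e
      <⟨ ℚₚ.+-monoˡ-< e close ⟩
    seq y N ℚ.+ 3e ℚ.+ e
      <⟨ ℚₚ.+-monoˡ-< e (ℚₚ.+-monoˡ-< 3e (∣p-q∣<ε⇒p<q+ε (seq y N) (seq y n)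
           (k N n (ℕₚ.m≤n⊔m M M′) (ℕₚ.m⊔n≤o⇒n≤o M M′ N≤n)))) ⟩
    seq y n ℚ.+ e ℚ.+ 3e ℚ.+ e
      ≡⟨ solve 2 (λ y ε → let e = con ⅕ :* ε in y :+ e :+ (e :+ e :+ e) :+ e := y :+ ε)
           refl (seq y n) ε ⟩
    seq y n ℚ.+ ε ∎
    where N = M ℕ.⊔ M′
  ... | no apart = contradiction (e , e>0 , N , λ n N≤n → begin-strict
    seq y n ℚ.+ e
      <⟨ ℚₚ.+-monoˡ-< e (∣p-q∣<ε⇒p<q+ε (seq y n) (seq y N)
           (k n N (ℕₚ.m⊔n≤o⇒n≤o M M′ N≤n) (ℕₚ.m≤n⊔m M M′))) ⟩
    seq y N ℚ.+ e ℚ.+ e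
      ≡⟨ solve 2 (λ y e → y :+ e :+ e := y :+ (e :+ e :+ e) :+ :- e) refl (seq y N) e ⟩
    seq y N ℚ.+ 3e ℚ.- e
      ≤⟨ ℚₚ.+-monoˡ-≤ (ℚ.- e) (ℚₚ.≮⇒≥ apart) ⟩
    seq x N ℚ.- e
      <⟨ p<q+ε⇒p-q<ε (seq x N) e (subst (seq x N ℚ.<_) (ℚₚ.+-comm (seq x n) e)
           (∣p-q∣<ε⇒p<q+ε (seq x N) (seq x n)
             (h N n (ℕₚ.m≤m⊔n M M′) (ℕₚ.m⊔n≤o⇒m≤o M M′ N≤n)))) ⟩
    seq x n ∎) y≮x
    where N = M ℕ.⊔ M′

-- By `≤⇒≯` and `≯⇒≤`, `x ≤ y` is equivalent to the negation of `y < x`, and negations are stable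
-- under double negation.
≤-stable : ∀ x y → ¬ ¬ (x ≤ y) → x ≤ y
≤-stable x y ¬¬x≤y = ≯⇒≤ x y λ y<x → ¬¬x≤y λ x≤y → ≤⇒≯ x y x≤y y<x

-- If both comparisons failed, `y < x` would be impossible because it implies `y ≤ x`; but then
-- `x ≤ y` follows from `≯⇒≤`. This replaces the undecidable case distinction on the order.
¬¬-≤-total : ∀ x y → ¬ ¬ (x ≤ y ⊎ y ≤ x)
¬¬-≤-total x y neither =
  neither (inj₁ (≯⇒≤ x y λ y<x → neither (inj₂ (<⇒≤ y x y<x))))

-- Arithmetic of reals

1ℝ : ℝ
-- The distance between two terms computes to `0ℚ`, so `ε>0` is already the required inequality.
1ℝ = mkℝ (λ _ → 1ℚ) λ ε ε>0 → 0 , λ _ _ _ _ → ε>0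

+-mono-≤ : ∀ x y z w → x ≤ y → z ≤ w → x + z ≤ y + w
+-mono-≤ x y z w x≤y z≤w ε ε>0 =
  eventually-map₂ step (x≤y _ (½-pos ε>0)) (z≤w _ (½-pos ε>0))
  where
  step : ∀ n → seq x n ℚ.< seq y n ℚ.+ ½ ℚ.* ε → seq z n ℚ.< seq w n ℚ.+ ½ ℚ.* ε →
         seq x n ℚ.+ seq z n ℚ.< seq y n ℚ.+ seq w n ℚ.+ ε
  step n h k = begin-strict
    seq x n ℚ.+ seq z n
      <⟨ ℚₚ.+-mono-< h k ⟩
    (seq y n ℚ.+ ½ ℚ.* ε) ℚ.+ (seq w n ℚ.+ ½ ℚ.* ε)
      ≡⟨ solve 3 (λ y w ε → (y :+ con ½ :* ε) :+ (w :+ con ½ :* ε) := y :+ w :+ ε)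
           refl (seq y n) (seq w n) ε ⟩
    seq y n ℚ.+ seq w n ℚ.+ ε ∎
    where open ℚₚ.≤-Reasoning

+-cong : ∀ x y z w → x ≃ y → z ≃ w → x + z ≃ y + w
+-cong x y z w x≃y z≃w = ≤-antisym (x + z) (y + w)
  (+-mono-≤ x y z w (≃⇒≤ x y x≃y) (≃⇒≤ z w z≃w))
  (+-mono-≤ y x w z (≃⇒≤ y x (≃-sym x y x≃y)) (≃⇒≤ w z (≃-sym z w z≃w)))

-‿cong : ∀ x y → x ≃ y → - x ≃ - y
-‿cong x y x≃y ε ε>0 = eventually-map
  (λ n → subst (λ t → ∣ t ∣ ℚ.< ε)
    (solve 2 (λ x y → y :+ :- x := :- x :+ :- (:- y)) refl (seq x n) (seq y n)))
  (≃-sym x y x≃y ε ε>0)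

∣c∣<B∧∣p-q∣<δ⇒∣cp-cq∣<Bδ : ∀ c p q {B δ} → 0ℚ ℚ.< B → ∣ c ∣ ℚ.< B → ∣ p ℚ.- q ∣ ℚ.< δ →
                           ∣ c ℚ.* p ℚ.- c ℚ.* q ∣ ℚ.< B ℚ.* δ
∣c∣<B∧∣p-q∣<δ⇒∣cp-cq∣<Bδ c p q {B} {δ} B>0 h k = begin-strict
  ∣ c ℚ.* p ℚ.- c ℚ.* q ∣
    ≡⟨ cong ∣_∣ (solve 3 (λ c p q → c :* p :+ :- (c :* q) := c :* (p :+ :- q)) refl c p q) ⟩
  ∣ c ℚ.* (p ℚ.- q) ∣     ≡⟨ ℚₚ.∣p*q∣≡∣p∣*∣q∣ c (p ℚ.- q) ⟩
  ∣ c ∣ ℚ.* ∣ p ℚ.- q ∣   ≤⟨ ℚₚ.*-monoʳ-≤-nonNeg ∣ p ℚ.- q ∣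
                               {{ℚₚ.∣-∣-nonNeg (p ℚ.- q)}} (ℚₚ.<⇒≤ h) ⟩
  B ℚ.* ∣ p ℚ.- q ∣       <⟨ ℚₚ.*-monoʳ-<-pos B {{ℚ.positive B>0}} k ⟩
  B ℚ.* δ                 ∎
  where open ℚₚ.≤-Reasoning

-- The terms of `c` are eventually bounded by some `B`, so tolerance `ε / B` for `x ≃ y` gives
-- tolerance `ε` for the products.
*-congˡ : ∀ c x y → x ≃ y → c * x ≃ c * y
*-congˡ c x y x≃y ε ε>0 =
  let B , B>0 , c<B  = bounded c
      δ , δ>0 , Bδ≡ε = rescale B>0 ε>0
  in eventually-map₂
       (λ n h k → subst (∣ seq c n ℚ.* seq x n ℚ.- seq c n ℚ.* seq y n ∣ ℚ.<_) Bδ≡ε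
         (∣c∣<B∧∣p-q∣<δ⇒∣cp-cq∣<Bδ (seq c n) (seq x n) (seq y n) B>0 h k))
       c<B (x≃y δ δ>0)

*-comm : ∀ x y → x * y ≃ y * x
*-comm x y = pointwise⇒≃ (x * y) (y * x) λ n → ℚₚ.*-comm (seq x n) (seq y n)

*-cong : ∀ x y z w → x ≃ y → z ≃ w → x * z ≃ y * w
*-cong x y z w x≃y z≃w = ≃-trans (x * z) (x * w) (y * w) (*-congˡ x z w z≃w)
  (≃-trans (x * w) (w * x) (y * w) (*-comm x w)
    (≃-trans (w * x) (w * y) (y * w) (*-congˡ w x y x≃y) (*-comm w y)))

-- Packaged as a bundle to obtain the general theory of finite sums: distributivity over `sum` and
-- the interchange of double sums, both needed at the leaves.
ℝ-commutativeRing : CommutativeRing 0ℓ 0ℓ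
ℝ-commutativeRing = record
  { Carrier = ℝ ; _≈_ = _≃_ ; _+_ = _+_ ; _*_ = _*_ ; -_ = -_ ; 0# = 0ℝ ; 1# = 1ℝ
  ; isCommutativeRing = record
    { isRing = record
      { +-isAbelianGroup = record
        { isGroup = record
          { isMonoid = record
            { isSemigroup = record
              { isMagma = record
                { isEquivalence = record
                  { refl  = λ {x} → ≃-refl x
                  ; sym   = λ {x} {y} → ≃-sym x y
                  ; trans = λ {x} {y} {z} → ≃-trans x y z
                  }
                ; ∙-cong = λ {x} {y} {z} {w} → +-cong x y z w
                }
              ; assoc = λ x y z → pointwise⇒≃ (x + y + z) (x + (y + z)) λ n →
                  ℚₚ.+-assoc (seq x n) (seq y n) (seq z n)
              }
            ; identity =
                (λ x → pointwise⇒≃ (0ℝ + x) x λ n → ℚₚ.+-identityˡ (seq x n)) ,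
                (λ x → pointwise⇒≃ (x + 0ℝ) x λ n → ℚₚ.+-identityʳ (seq x n))
            }
          ; inverse =
              (λ x → pointwise⇒≃ (- x + x) 0ℝ λ n → ℚₚ.+-inverseˡ (seq x n)) ,
              (λ x → pointwise⇒≃ (x - x) 0ℝ λ n → ℚₚ.+-inverseʳ (seq x n))
          ; ⁻¹-cong = λ {x} {y} → -‿cong x y
          }
        ; comm = λ x y → pointwise⇒≃ (x + y) (y + x) λ n → ℚₚ.+-comm (seq x n) (seq y n)
        }
      ; *-cong = λ {x} {y} {z} {w} → *-cong x y z w
      ; *-assoc = λ x y z → pointwise⇒≃ (x * y * z) (x * (y * z)) λ n →
          ℚₚ.*-assoc (seq x n) (seq y n) (seq z n)
      ; *-identity =
          (λ x → pointwise⇒≃ (1ℝ * x) x λ n → ℚₚ.*-identityˡ (seq x n)) ,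
          (λ x → pointwise⇒≃ (x * 1ℝ) x λ n → ℚₚ.*-identityʳ (seq x n))
      ; distrib =
          (λ x y z → pointwise⇒≃ (x * (y + z)) (x * y + x * z) λ n →
            ℚₚ.*-distribˡ-+ (seq x n) (seq y n) (seq z n)) ,
          (λ x y z → pointwise⇒≃ ((y + z) * x) (y * x + z * x) λ n →
            ℚₚ.*-distribʳ-+ (seq x n) (seq y n) (seq z n))
      }
    ; *-comm = *-comm
    }
  }

module R where
  open CommutativeRing ℝ-commutativeRing public
  -- The `sum` of the statement unfolds to the same fold as the hidden one, so these lemmas apply to
  -- it directly.
  open SemiringSum semiring public hiding (sum)

-- Monotonicity of multiplication and of sums

0<c<B∧p<q+δ⇒cp<cq+Bδ : ∀ c p q {B δ} → 0ℚ ℚ.< c → c ℚ.< B → 0ℚ ℚ.< δ → p ℚ.< q ℚ.+ δ →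
                       c ℚ.* p ℚ.< c ℚ.* q ℚ.+ B ℚ.* δ
0<c<B∧p<q+δ⇒cp<cq+Bδ c p q {B} {δ} c>0 c<B δ>0 p<q+δ = begin-strict
  c ℚ.* p               <⟨ ℚₚ.*-monoʳ-<-pos c {{ℚ.positive c>0}} p<q+δ ⟩
  c ℚ.* (q ℚ.+ δ)       ≡⟨ ℚₚ.*-distribˡ-+ c q δ ⟩
  c ℚ.* q ℚ.+ c ℚ.* δ   <⟨ ℚₚ.+-monoʳ-< (c ℚ.* q)
                             (ℚₚ.*-monoˡ-<-pos δ {{ℚ.positive δ>0}} c<B) ⟩
  c ℚ.* q ℚ.+ B ℚ.* δ   ∎
  where open ℚₚ.≤-Reasoning

-- The gap `η` in `0ℝ < c` makes the terms of `c` eventually positive, and boundedness puts them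
-- below `B`. Multiplying `x ≤ y` at tolerance `ε / B` by such terms leaves an error below `ε`.
*-monoˡ-≤-pos : ∀ c x y → 0ℝ < c → x ≤ y → c * x ≤ c * y
*-monoˡ-≤-pos c x y (η , η>0 , 0+η<c) x≤y ε ε>0 =
  let B , B>0 , c<B  = bounded c
      δ , δ>0 , Bδ≡ε = rescale B>0 ε>0
      0<c<B = eventually-map₂
        (λ n h k → ℚₚ.<-trans η>0 (subst (ℚ._< seq c n) (ℚₚ.+-identityˡ η) h)
                 , ℚₚ.≤-<-trans (p≤∣p∣ (seq c n)) k)
        0+η<c c<B
  in eventually-map₂
       (λ n (0<cₙ , cₙ<B) h →
         subst (λ t → seq c n ℚ.* seq x n ℚ.< seq c n ℚ.* seq y n ℚ.+ t) Bδ≡ε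
           (0<c<B∧p<q+δ⇒cp<cq+Bδ (seq c n) (seq x n) (seq y n) 0<cₙ cₙ<B δ>0 h))
       0<c<B (x≤y δ δ>0)

neg-antimono-≤ : ∀ x y → x ≤ y → - y ≤ - x
neg-antimono-≤ x y x≤y ε ε>0 = eventually-map step (x≤y ε ε>0)
  where
  open ℚₚ.≤-Reasoning
  step : ∀ n → seq x n ℚ.< seq y n ℚ.+ ε → ℚ.- seq y n ℚ.< ℚ.- seq x n ℚ.+ ε
  step n h = begin-strict
    ℚ.- seq y n
      ≡⟨ solve 2 (λ x y → :- y := x :+ :- (x :+ y)) refl (seq x n) (seq y n) ⟩
    seq x n ℚ.- (seq x n ℚ.+ seq y n)
      <⟨ ℚₚ.+-monoˡ-< (ℚ.- (seq x n ℚ.+ seq y n)) h ⟩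
    seq y n ℚ.+ ε ℚ.- (seq x n ℚ.+ seq y n)
      ≡⟨ solve 3 (λ x y e → y :+ e :+ :- (x :+ y) := :- x :+ e) refl (seq x n) (seq y n) ε ⟩
    ℚ.- seq x n ℚ.+ ε ∎

x<0⇒0<-x : ∀ x → x < 0ℝ → 0ℝ < - x
x<0⇒0<-x x (ε , ε>0 , x+ε<0) = ε , ε>0 , eventually-map step x+ε<0
  where
  open ℚₚ.≤-Reasoning
  step : ∀ n → seq x n ℚ.+ ε ℚ.< 0ℚ → 0ℚ ℚ.+ ε ℚ.< ℚ.- seq x n
  step n h = begin-strict
    0ℚ ℚ.+ ε                      ≡⟨ solve 2 (λ x e → con 0ℚ :+ e := x :+ e :+ :- x) refl (seq x n) ε ⟩
    seq x n ℚ.+ ε ℚ.- seq x n     <⟨ ℚₚ.+-monoˡ-< (ℚ.- seq x n) h ⟩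
    0ℚ ℚ.- seq x n                ≡⟨ ℚₚ.+-identityˡ (ℚ.- seq x n) ⟩
    ℚ.- seq x n                   ∎

≤-respʳ-≃ : ∀ x y z → y ≃ z → x ≤ y → x ≤ z
≤-respʳ-≃ x y z y≃z x≤y = ≤-trans x y z x≤y (≃⇒≤ y z y≃z)

≤-respˡ-≃ : ∀ x y z → x ≃ y → x ≤ z → y ≤ z
≤-respˡ-≃ x y z x≃y = ≤-trans y x z (≃⇒≤ y x (≃-sym x y x≃y))

-- Reduces to the positive factor `- c`; negating the resulting inequality reverses it and removes
-- the sign.
*-monoˡ-≤-neg : ∀ c x y → c < 0ℝ → x ≤ y → c * y ≤ c * x
*-monoˡ-≤-neg c x y c<0 x≤y =
  ≤-respˡ-≃ (- (- c * y)) (c * y) (c * x) (neg-neg-* y)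
    (≤-respʳ-≃ (- (- c * y)) (- (- c * x)) (c * x) (neg-neg-* x)
      (neg-antimono-≤ (- c * x) (- c * y) (*-monoˡ-≤-pos (- c) x y (x<0⇒0<-x c c<0) x≤y)))
  where
  neg-neg-* : ∀ z → - (- c * z) ≃ c * z
  neg-neg-* z = pointwise⇒≃ (- (- c * z)) (c * z) λ n →
    solve 2 (λ c z → :- (:- c :* z) := c :* z) refl (seq c n) (seq z n)

sum-mono-≤ : ∀ {n} (x y : Vector ℝ n) → x ≤ᵛ y → sum x ≤ sum y
sum-mono-≤ {ℕ.zero}  x y x≤y = ≃⇒≤ 0ℝ 0ℝ (≃-refl 0ℝ)
sum-mono-≤ {ℕ.suc n} x y x≤y = +-mono-≤
  (x zero) (y zero) (sum λ j → x (suc j)) (sum λ j → y (suc j))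
  (x≤y zero) (sum-mono-≤ (λ j → x (suc j)) (λ j → y (suc j)) (λ j → x≤y (suc j)))

-- Maximum with zero

x≤0⇒max≃0 : ∀ x → x ≤ 0ℝ → max x 0ℝ ≃ 0ℝ
x≤0⇒max≃0 x x≤0 = ≤-antisym (max x 0ℝ) 0ℝ
  (λ ε ε>0 → eventually-map (step ε ε>0) (x≤0 ε ε>0))
  (pointwise⇒≤ 0ℝ (max x 0ℝ) λ n → ℚₚ.p≤q⊔p (seq x n) 0ℚ)
  where
  -- Terms of `x` may be positive although `x ≤ 0ℝ`, so the termwise maximum need not be zero; it
  -- only falls below each `ε` eventually, which suffices for `≃`.
  step : ∀ ε → 0ℚ ℚ.< ε → ∀ n → seq x n ℚ.< 0ℚ ℚ.+ ε → seq x n ℚ.⊔ 0ℚ ℚ.< 0ℚ ℚ.+ ε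
  step ε ε>0 n h with ℚₚ.⊔-sel (seq x n) 0ℚ
  ... | inj₁ e = subst (ℚ._< 0ℚ ℚ.+ ε) (sym e) h
  ... | inj₂ e = subst (ℚ._< 0ℚ ℚ.+ ε) (sym e) (p<p+ε 0ℚ ε>0)

0≤x⇒max≃x : ∀ x → 0ℝ ≤ x → max x 0ℝ ≃ x
0≤x⇒max≃x x 0≤x = ≤-antisym (max x 0ℝ) x
  (λ ε ε>0 → eventually-map (step ε ε>0) (0≤x ε ε>0))
  (pointwise⇒≤ x (max x 0ℝ) λ n → ℚₚ.p≤p⊔q (seq x n) 0ℚ)
  where
  step : ∀ ε → 0ℚ ℚ.< ε → ∀ n → 0ℚ ℚ.< seq x n ℚ.+ ε → seq x n ℚ.⊔ 0ℚ ℚ.< seq x n ℚ.+ ε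
  step ε ε>0 n h with ℚₚ.⊔-sel (seq x n) 0ℚ
  ... | inj₁ e = subst (ℚ._< seq x n ℚ.+ ε) (sym e) (p<p+ε (seq x n) ε>0)
  ... | inj₂ e = subst (ℚ._< seq x n ℚ.+ ε) (sym e) h

-- Leaves

-- This is `(wᵀA)s = wᵀ(As)`: expand the product inside the outer sum, interchange the two finite
-- sums, and factor `w i` out of the inner one.
ᵛ*-*ᵛ-assoc : ∀ {m n} (w : Vector ℝ m) (A : Matrix m n) (s : Vector ℝ n) →
              sum (λ j → (w ᵛ* A) j * s j) ≃ sum (λ i → w i * (A *ᵛ s) i)
ᵛ*-*ᵛ-assoc w A s = begin
  sum (λ j → (w ᵛ* A) j * s j)
    ≈⟨ R.sum-cong-≋ (λ j → R.*-distribʳ-sum (s j) (λ i → w i * A i j)) ⟩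
  sum (λ j → sum λ i → w i * A i j * s j)
    ≈⟨ R.∑-comm (λ j i → w i * A i j * s j) ⟩
  sum (λ i → sum λ j → w i * A i j * s j)
    ≈⟨ R.sum-cong-≋ (λ i → R.sum-cong-≋ λ j → R.*-assoc (w i) (A i j) (s j)) ⟩
  sum (λ i → sum λ j → w i * (A i j * s j))
    ≈⟨ R.sum-cong-≋ (λ i → R.*-distribˡ-sum (w i) (λ j → A i j * s j)) ⟨
  sum (λ i → w i * (A *ᵛ s) i) ∎
  where open SetoidReasoning R.setoid

*ᵛ-kernel⇒ᵛ*-orthogonal : ∀ {m n} (w : Vector ℝ m) (A : Matrix m n) (s : Vector ℝ n) →
                          (∀ i → (A *ᵛ s) i ≃ 0ℝ) → sum (λ j → (w ᵛ* A) j * s j) ≃ 0ℝ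
*ᵛ-kernel⇒ᵛ*-orthogonal {m} w A s As≃0 = begin
  sum (λ j → (w ᵛ* A) j * s j)
    ≈⟨ ᵛ*-*ᵛ-assoc w A s ⟩
  sum (λ i → w i * (A *ᵛ s) i)
    ≈⟨ R.sum-cong-≋ (λ i → *-congˡ (w i) ((A *ᵛ s) i) 0ℝ (As≃0 i)) ⟩
  sum (λ i → w i * 0ℝ)
    ≈⟨ R.sum-cong-≋ (λ i → R.zeroʳ (w i)) ⟩
  sum {m} (λ _ → 0ℝ)
    ≈⟨ R.sum-replicate-zero m ⟩
  0ℝ ∎
  where open SetoidReasoning R.setoid

-- t⁺ and t⁻ are the summands of the leaf check at one coordinate.
term-bound : ∀ γ s u l t⁺ t⁻ → l ≤ s → s ≤ u →
             (0ℝ < γ → t⁺ ≃ γ * u) → (¬ (0ℝ < γ) → t⁺ ≃ 0ℝ) →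
             (γ < 0ℝ → t⁻ ≃ γ * l) → (¬ (γ < 0ℝ) → t⁻ ≃ 0ℝ) →
             γ * s ≤ t⁺ + t⁻
term-bound γ s u l t⁺ t⁻ l≤s s≤u pos ¬pos neg ¬neg =
  -- The sign of `γ` is undecidable, but the goal is stable. Assuming that it fails rules out both
  -- strict signs, and the remaining case of `γ` equal to zero proves it.
  ≤-stable (γ * s) (t⁺ + t⁻) λ fails →
    let γ≯0 : ¬ (0ℝ < γ)
        γ≯0 γ>0 = fails (positive γ>0)
        γ≮0 : ¬ (γ < 0ℝ)
        γ≮0 γ<0 = fails (negative γ<0)
    in fails (null γ≯0 γ≮0)
  where
  conclude : ∀ a b → t⁺ ≃ a → t⁻ ≃ b → γ * s ≤ a + b → γ * s ≤ t⁺ + t⁻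
  conclude a b t⁺≃a t⁻≃b = ≤-respʳ-≃ (γ * s) (a + b) (t⁺ + t⁻)
    (+-cong a t⁺ b t⁻ (≃-sym t⁺ a t⁺≃a) (≃-sym t⁻ b t⁻≃b))

  positive : 0ℝ < γ → γ * s ≤ t⁺ + t⁻
  -- A positive `γ` cannot be negative, so `t⁻` vanishes and only the upper bound contributes.
  positive γ>0 = conclude (γ * u) 0ℝ (pos γ>0) (¬neg (≤⇒≯ 0ℝ γ (<⇒≤ 0ℝ γ γ>0)))
    (≤-respʳ-≃ (γ * s) (γ * u) (γ * u + 0ℝ) (≃-sym (γ * u + 0ℝ) (γ * u) (R.+-identityʳ (γ * u)))
      (*-monoˡ-≤-pos γ s u γ>0 s≤u))

  negative : γ < 0ℝ → γ * s ≤ t⁺ + t⁻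
  negative γ<0 = conclude 0ℝ (γ * l) (¬pos (≤⇒≯ γ 0ℝ (<⇒≤ γ 0ℝ γ<0))) (neg γ<0)
    (≤-respʳ-≃ (γ * s) (γ * l) (0ℝ + γ * l) (≃-sym (0ℝ + γ * l) (γ * l) (R.+-identityˡ (γ * l)))
      (*-monoˡ-≤-neg γ l s γ<0 l≤s))

  null : ¬ (0ℝ < γ) → ¬ (γ < 0ℝ) → γ * s ≤ t⁺ + t⁻
  null γ≯0 γ≮0 = conclude 0ℝ 0ℝ (¬pos γ≯0) (¬neg γ≮0) (≃⇒≤ (γ * s) (0ℝ + 0ℝ) (begin
    γ * s      ≈⟨ *-cong γ 0ℝ s s (≤-antisym γ 0ℝ (≯⇒≤ γ 0ℝ γ≯0) (≯⇒≤ 0ℝ γ γ≮0)) (≃-refl s) ⟩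
    0ℝ * s     ≈⟨ R.zeroˡ s ⟩
    0ℝ         ≈⟨ R.+-identityˡ 0ℝ ⟨
    0ℝ + 0ℝ    ∎))
    where open SetoidReasoning R.setoid

leaf-sound : ∀ {m n} (A : Matrix m n) (u l : Vector ℝ n) (C : List (ReluConstraint n)) w →
             LeafCheck A u l w → ∀ s → ¬ IsSolution A u l C s
leaf-sound A u l C w
  (len , σ⁺ , σ⁻ , (t⁺ , pos , ¬pos , σ⁺≃) , (t⁻ , neg , ¬neg , σ⁻≃) , σ<0) s sol =
  ≤⇒≯ 0ℝ (σ⁺ + σ⁻) 0≤σ σ<0
  where
  open IsSolution sol
  v = λ i → lookup w (cast (sym len) i)
  γs = λ j → (v ᵛ* A) j * s j
  -- Merging the two summand vectors allows a coordinatewise comparison with `γs`; the sum splits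
  -- again into `σ⁺ + σ⁻`.
  t = λ j → t⁺ j + t⁻ j

  Σt≃σ : sum t ≃ σ⁺ + σ⁻
  Σt≃σ = ≃-trans (sum t) (sum t⁺ + sum t⁻) (σ⁺ + σ⁻) (R.∑-distrib-+ t⁺ t⁻)
    (+-cong (sum t⁺) σ⁺ (sum t⁻) σ⁻ (≃-sym σ⁺ (sum t⁺) σ⁺≃) (≃-sym σ⁻ (sum t⁻) σ⁻≃))

  Σγs≤Σt : sum γs ≤ sum t
  Σγs≤Σt = sum-mono-≤ γs t λ j →
    term-bound ((v ᵛ* A) j) (s j) (u j) (l j) (t⁺ j) (t⁻ j) (lower j) (upper j)
      (pos j) (¬pos j) (neg j) (¬neg j)

  0≤σ : 0ℝ ≤ σ⁺ + σ⁻
  0≤σ = ≤-respˡ-≃ (sum γs) 0ℝ (σ⁺ + σ⁻) (*ᵛ-kernel⇒ᵛ*-orthogonal v A s kernel)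
    (≤-respʳ-≃ (sum γs) (sum t) (σ⁺ + σ⁻) Σt≃σ Σγs≤Σt)

-- Splits

position-injective : ∀ {n} {i j : Fin n} → position i ≡ position j → i ≡ j
position-injective e = toℕ-injective (ℕₚ.suc-injective e)

position-surjective : ∀ {n} i → 1 ℕ.≤ i → i ℕ.≤ n → ∃ λ (j : Fin n) → position j ≡ i
-- Positions count from 1 and coordinates from 0: the bound `suc i ≤ n` is exactly `i < n`, as
-- required by `fromℕ<`.
position-surjective (ℕ.suc i) _ i<n = fromℕ< i<n , cong ℕ.suc (toℕ-fromℕ< i<n)

update-upper : ∀ {n} (s u : Vector ℝ n) i k → s ≤ᵛ u → s i ≤ k → s ≤ᵛ u [ position i ↦ k ]
update-upper s u i k s≤u si≤k j with position j ℕₚ.≟ position i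
... | yes e = subst (λ j → s j ≤ k) (position-injective (sym e)) si≤k
... | no  _ = s≤u j

update-lower : ∀ {n} (s l : Vector ℝ n) i k → l ≤ᵛ s → k ≤ s i → l [ position i ↦ k ] ≤ᵛ s
update-lower s l i k l≤s k≤si j with position j ℕₚ.≟ position i
... | yes e = subst (λ j → k ≤ s j) (position-injective (sym e)) k≤si
... | no  _ = l≤s j

WithinBounds : ∀ {n} → Vector ℝ n → Bounds n → Set
WithinBounds s (l , u) = l ≤ᵛ s × s ≤ᵛ u

-- Both halves are closed at `k`, so a weak comparison of `s i` with `k` already selects one of
-- them.
singleVar-covers : ∀ {n} (s l u : Vector ℝ n) (i : Fin n) k → WithinBounds s (l , u) →
  let boundsᴸ , boundsᴿ = updateBounds l u (SingleVar (position i) k) in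
  ¬ ¬ (WithinBounds s boundsᴸ ⊎ WithinBounds s boundsᴿ)
singleVar-covers s l u i k (l≤s , s≤u) neither = ¬¬-≤-total (s i) k
  [ (λ si≤k → neither (inj₁ (l≤s , update-upper s u i k s≤u si≤k)))
  , (λ k≤si → neither (inj₂ (update-lower s l i k l≤s k≤si , s≤u)))
  ]′

-- The sign of `s b` selects the phase. If `s b ≤ 0ℝ`, the maximum vanishes and so does `s f`. If
-- `0ℝ ≤ s b`, then `s f` equals `s b`, and the auxiliary equation forces `s a` to vanish.
relu-covers : ∀ {n} (s l u : Vector ℝ n) (b f a : Fin n) → Satisfies s (b , f , a) →
  WithinBounds s (l , u) →
  let boundsᴸ , boundsᴿ = updateBounds l u (Relu (position b) (position f) (position a)) in
  ¬ ¬ (WithinBounds s boundsᴸ ⊎ WithinBounds s boundsᴿ)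
relu-covers s l u b f a (sf≃max , aux) (l≤s , s≤u) neither = ¬¬-≤-total (s b) 0ℝ
  [ (λ sb≤0 → neither (inj₁ (inactive sb≤0))) , (λ 0≤sb → neither (inj₂ (active 0≤sb))) ]′
  where
  inactive : s b ≤ 0ℝ → WithinBounds s (proj₁ (updateBounds l u (Relu (position b) (position f) (position a))))
  inactive sb≤0 =
    update-lower s l f 0ℝ l≤s (≃⇒≤ 0ℝ (s f) (≃-sym (s f) 0ℝ sf≃0)) ,
    update-upper s (u [ position b ↦ 0ℝ ]) f 0ℝ (update-upper s u b 0ℝ s≤u sb≤0) (≃⇒≤ (s f) 0ℝ sf≃0)
    where
    sf≃0 : s f ≃ 0ℝ
    sf≃0 = ≃-trans (s f) (max (s b) 0ℝ) 0ℝ sf≃max (x≤0⇒max≃0 (s b) sb≤0)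

  active : 0ℝ ≤ s b → WithinBounds s (proj₂ (updateBounds l u (Relu (position b) (position f) (position a))))
  active 0≤sb =
    update-lower s (l [ position b ↦ 0ℝ ]) a 0ℝ (update-lower s l b 0ℝ l≤s 0≤sb)
      (≃⇒≤ 0ℝ (s a) (≃-sym (s a) 0ℝ sa≃0)) ,
    update-upper s u a 0ℝ s≤u (≃⇒≤ (s a) 0ℝ sa≃0)
    where
    open SetoidReasoning R.setoid
    sf≃sb : s f ≃ s b
    sf≃sb = ≃-trans (s f) (max (s b) 0ℝ) (s b) sf≃max (0≤x⇒max≃x (s b) 0≤sb)

    sa≃0 : s a ≃ 0ℝ
    sa≃0 = begin
      s a
        -- Rewritten so that both known equations apply: `s f` can be replaced by `s b`, and the
        -- subtracted bracket is zero by `aux`.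
        ≈⟨ pointwise⇒≃ (s a) (s f - s b - (s f - s b - s a)) (λ n →
             solve 3 (λ a b f → a := (f :+ :- b) :+ :- ((f :+ :- b) :+ :- a))
               refl (seq (s a) n) (seq (s b) n) (seq (s f) n)) ⟩
      s f - s b - (s f - s b - s a)
        ≈⟨ +-cong (s f - s b) (s b - s b) (- (s f - s b - s a)) (- 0ℝ)
             (+-cong (s f) (s b) (- s b) (- s b) sf≃sb (≃-refl (- s b)))
             (-‿cong (s f - s b - s a) 0ℝ aux) ⟩
      s b - s b - 0ℝ
        ≈⟨ pointwise⇒≃ (s b - s b - 0ℝ) 0ℝ (λ n →
             solve 1 (λ b → (b :+ :- b) :+ :- con 0ℚ := con 0ℚ) refl (seq (s b) n)) ⟩
      0ℝ ∎

split-covers : ∀ {n} (s l u : Vector ℝ n) (C : List (ReluConstraint n)) σ → ValidSplit C σ →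
  (∀ c → c ∈ C → Satisfies s c) → WithinBounds s (l , u) →
  ¬ ¬ (WithinBounds s (proj₁ (updateBounds l u σ)) ⊎ WithinBounds s (proj₂ (updateBounds l u σ)))
split-covers s l u C (SingleVar i k) (1≤i , i≤n) sat within
  with position-surjective i 1≤i i≤n
-- Matching on `refl` turns the numeric index into the position of the coordinate `j`.
... | j , refl = singleVar-covers s l u j k within
split-covers s l u C (Relu b f a) (bfa∈ , _) sat within with ∈-map⁻ positions bfa∈
-- The numeric triple of the split is the image of an actual constraint in `C`, which `s` satisfies.
... | (b′ , f′ , a′) , c∈C , refl = relu-covers s l u b′ f′ a′ (sat _ c∈C) within

-- Induction on the tree with the bounds left general, as they change at every node while `A`, `C`
-- and `s` stay fixed. The goal is `⊥`, so the doubly negated covering of `split-covers` may be used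
-- as a case distinction.
checkTree-sound : ∀ {m n} (A : Matrix m n) (u l : Vector ℝ n) (C : List (ReluConstraint n)) T →
                  CheckTree A u l C T → ∀ s → ¬ IsSolution A u l C s
checkTree-sound A u l C (Leaf w) check s sol = leaf-sound A u l C w check s sol
checkTree-sound A u l C (Node σ Tᴸ Tᴿ) (valid , checkᴸ , checkᴿ) s sol =
  split-covers s l u C σ valid constraints (lower , upper)
    [ (λ within → checkTree-sound A _ _ C Tᴸ checkᴸ s (solution within))
    , (λ within → checkTree-sound A _ _ C Tᴿ checkᴿ s (solution within))
    ]′
  where
  open IsSolution sol
  -- Only the bounds differ between a node and its children; the kernel equations and the ReLU
  -- constraints carry over.
  solution : ∀ {bounds} → WithinBounds s bounds → IsSolution A (proj₂ bounds) (proj₁ bounds) C s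
  solution (l≤s , s≤u) = record
    { kernel = kernel ; lower = l≤s ; upper = s≤u ; constraints = constraints }

mainTheorem8 : (m n : ℕ) → m ≥ 1 → n ≥ 1 → (A : Matrix m n) (u l : Vector ℝ n) (C : List (ReluConstraint n)) (T : ProofTree) → CheckTree A u l C T → ¬ (∃ λ (s : Vector ℝ n) → IsSolution A u l C s)
mainTheorem8 m n _ _ A u l C T check (s , sol) = checkTree-sound A u l C T check s sol
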